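{- Let $C_n$ denote the cycle on $n$ vertices. For every integer $m\geq 3$ there is an integer $N$ such that for all $n\geq N$ the graph $(C_n)^m$ is not $2m$-ordered.
   Context: All graphs are finite simple graphs. $d_G(v,w)$ denotes the distance in $G$ between vertices $v$ and $w$. For a positive integer $p$, the $p$-th power $G^p$ of a graph $G$ is the simple graph with the same vertex set as $G$ in which two distinct vertices $v,w$ are adjacent if and only if $d_G(v,w)\leq p$. A graph $G$ is $k$-ordered if for any sequence $v_1,v_2,\dots,v_k$ of $k$ distinct vertices of $G$ there is a cycle in $G$ (not necessarily Hamiltonian) containing these vertices in the given order, i.e. traversing the cycle from $v_1$ in one of its two directions, one meets $v_1,v_2,\dots,v_k$ in this order before returning to $v_1$. -}

module Defs where

open import Data.Empty using (⊥)
open import Data.Fin.Base using (Fin; toℕ; _<_)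
open import Data.Nat.Base using (ℕ; suc; _≤_; s≤s)
open import Data.Nat.Properties using (1+n≢n)
open import Data.Product.Base using (∃-syntax; _×_; _,_)
open import Data.Sum.Base using (_⊎_; inj₁; inj₂; swap)
open import Function.Definitions using (Injective)
open import Relation.Binary.Core using (Rel; _Preserves_⟶_)
open import Relation.Binary.Definitions using (Symmetric; Irreflexive)
open import Relation.Binary.PropositionalEquality.Core
  using (_≡_; _≢_; refl; sym; trans; cong; ≢-sym)
open import Level using (0ℓ)

-- The graph has order n: its vertex set is Fin n.
record Graph (n : ℕ) : Set₁ where
  field
    Adj        : Rel (Fin n) 0ℓ
    adj-sym    : Symmetric Adj
    adj-irrefl : Irreflexive _≡_ Adj

open Graph public

data Walk {n} (G : Graph n) : Fin n → Fin n → ℕ → Set where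
  nil  : ∀ {v} → Walk G v v 0
  cons : ∀ {u v w ℓ} → Adj G u v → Walk G v w ℓ → Walk G u w (suc ℓ)

-- d_G(v,w) = d.  The distance is a relation because it is infinite, that is,
-- related to no d, when v and w lie in different components.
record IsDistance {n} (G : Graph n) (v w : Fin n) (d : ℕ) : Set where
  field
    attained : Walk G v w d
    minimal  : ∀ {ℓ} → Walk G v w ℓ → d ≤ ℓ

open IsDistance public

private
  snoc : ∀ {n} {G : Graph n} {u v w ℓ} → Walk G u v ℓ → Adj G v w → Walk G u w (suc ℓ)
  snoc nil        e = cons e nil
  snoc (cons f p) e = cons f (snoc p e)

  reverse : ∀ {n} {G : Graph n} {v w ℓ} → Walk G v w ℓ → Walk G w v ℓ
  reverse nil                = nil
  reverse {G = G} (cons e p) = snoc (reverse p) (adj-sym G e)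

  distance-sym : ∀ {n} {G : Graph n} {v w d} → IsDistance G v w d → IsDistance G w v d
  distance-sym D = record
    { attained = reverse (attained D)
    ; minimal  = λ p → minimal D (reverse p)
    }

power : ∀ {n} → Graph n → ℕ → Graph n
power G p = record
  { Adj        = λ v w → v ≢ w × ∃[ d ] (IsDistance G v w d × d ≤ p)
  ; adj-sym    = λ (v≢w , d , D , d≤p) → ≢-sym v≢w , d , distance-sym D , d≤p
  ; adj-irrefl = λ v≡w (v≢w , _) → v≢w v≡w
  }

-- j ≡ i + 1 (mod n)
Next : ∀ {n} → Rel (Fin n) 0ℓ
Next {n} i j = suc (toℕ i) ≡ toℕ j ⊎ (suc (toℕ i) ≡ n × toℕ j ≡ 0)

private
  next-irrefl : ∀ {n} → 3 ≤ n → {i : Fin n} → Next i i → ⊥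
  next-irrefl _ (inj₁ 1+i≡i) = 1+n≢n 1+i≡i
  next-irrefl 3≤n (inj₂ (1+i≡n , i≡0)) with trans (sym 1+i≡n) (cong suc i≡0)
  next-irrefl (s≤s ()) (inj₂ _) | refl

cycleGraph : ∀ n → 3 ≤ n → Graph n
cycleGraph n 3≤n = record
  { Adj        = λ i j → Next i j ⊎ Next j i
  ; adj-sym    = swap
  ; adj-irrefl = λ where
      refl (inj₁ s) → next-irrefl 3≤n s
      refl (inj₂ s) → next-irrefl 3≤n s
  }

-- A cycle of G together with a starting vertex and a direction of traversal:
-- vertex 0, vertex 1, …, vertex (length - 1), and back to vertex 0.
record Cycle {n} (G : Graph n) : Set where
  field
    length    : ℕ
    length≥3  : 3 ≤ length
    vertex    : Fin length → Fin n
    injective : Injective _≡_ _≡_ vertex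
    adjacent  : ∀ {i j} → Next i j → Adj G (vertex i) (vertex j)

-- The traversal C starts at the first term of v and meets the terms of v in
-- order before returning to its start.
record Meets {n k} {G : Graph n} (C : Cycle G) (v : Fin k → Fin n) : Set where
  open Cycle C
  field
    position   : Fin k → Fin length
    visits     : ∀ i → vertex (position i) ≡ v i
    start      : ∀ i → toℕ i ≡ 0 → toℕ (position i) ≡ 0
    increasing : position Preserves _<_ ⟶ _<_

-- Cycle ranges over all starting vertices and both directions, so the
-- existential chooses these along with the underlying cycle.
Ordered : ∀ {n} → ℕ → Graph n → Set
Ordered {n} k G =
  (v : Fin k → Fin n) → Injective _≡_ _≡_ v → ∃[ C ] Meets {G = G} C v

{-# OPTIONS --safe #-}
-- List the terms as m+1, 0, m+2, 1, …, 2m, m-1.  Consecutive terms are at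
-- distance m+1 or m+2 in the n-cycle, hence not adjacent in its m-th power, and
-- one of them lies in [m+1, 2m].  So a cycle meeting the terms in order contains,
-- strictly between any two consecutive ones, a neighbour of a vertex of
-- [m+1, 2m] that is not a term.  For n > 3m such a neighbour is m or lies in
-- [2m+1, 3m], which leaves m+1 values for 2m-1 distinct vertices: impossible
-- when m ≥ 3.
module Submission where

open import Defs
open import Data.Fin.Base as Fin using (Fin; toℕ; fromℕ<; inject₁)
import Data.Fin.Properties as Fin
open import Data.List.Base using (_∷_; [])
open import Data.Nat.Base
  using (ℕ; zero; suc; _≤_; _<_; _*_; _+_; _∸_; ∣_-_∣; z≤n; s≤s; s≤s⁻¹)
open import Data.Nat.Properties
open import Data.Nat.Tactic.RingSolver using (solve)
open import Data.Product.Base using (∃-syntax; _×_; _,_; proj₁; proj₂)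
open import Data.Sum.Base using (_⊎_; inj₁; inj₂; [_,_]′)
open import Function.Base using (_∘_)
open import Function.Definitions using (Injective)
open import Level using (0ℓ)
open import Relation.Binary.Definitions using (tri<; tri≈; tri>)
open import Relation.Binary.PropositionalEquality
  using (_≡_; _≢_; refl; sym; trans; cong; subst; subst₂)
open import Relation.Nullary.Negation using (¬_; contradiction)
open import Relation.Unary using (Pred)

private
  variable
    k m n : ℕ

-- Arcs of a cycle between consecutive terms.

module _ {G : Graph n} {C : Cycle G} {v : Fin (suc k) → Fin n} (M : Meets C v) where
  open Cycle C
  open Meets M

  position-reflects-< : ∀ {i j} → position i Fin.< position j → i Fin.< j
  position-reflects-< {i} {j} pi<pj with Fin.<-cmp i j
  ... | tri< i<j _ _    = i<j
  ... | tri≈ _ refl _   = contradiction pi<pj (<-irrefl refl)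
  ... | tri> _ _ j<i    = contradiction pi<pj (<-asym (increasing j<i))

  -- The arc from the last term back to the first is not indexed, so `2m` terms give `2m - 1` arcs.
  Between : Fin k → Fin length → Set
  Between t s = position (inject₁ t) Fin.< s × s Fin.< position (Fin.suc t)

  -- A term at position `s` would have an index strictly between `t` and `t + 1`.
  between⇒≢term : ∀ {t s} → Between t s → ∀ j → vertex s ≢ v j
  between⇒≢term {t} {s} (p<s , s<q) j eq
    with refl ← injective (trans eq (sym (visits j))) =
    <-irrefl refl (<-≤-trans
      (subst (_< toℕ j) (Fin.toℕ-inject₁ t) (position-reflects-< p<s))
      (s≤s⁻¹ (position-reflects-< s<q)))

  -- Keeps choices made on different arcs at different positions, as the pigeonhole argument
  -- requires.
  between-mono : ∀ {t t′ s s′} → t Fin.< t′ → Between t s → Between t′ s′ → s Fin.< s′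
  between-mono {t} {t′} t<t′ (_ , s<q) (p′<s′ , _) with Fin.<-cmp (Fin.suc t) (inject₁ t′)
  ... | tri< lt _ _   = <-trans s<q (<-trans (increasing lt) p′<s′)
  ... | tri≈ _ eq _   = <-trans s<q (subst (λ i → position i Fin.< _) (sym eq) p′<s′)
  ... | tri> _ _ gt   =
    contradiction (subst (_≤ toℕ t) (Fin.toℕ-inject₁ t′) (s≤s⁻¹ gt)) (<⇒≱ t<t′)

  -- Nonadjacent terms cannot occupy successive positions, so the successor of the first and the
  -- predecessor of the second both lie strictly inside the arc. The term satisfying `P` decides
  -- which of the two is taken.
  detour : ∀ t → ¬ Adj G (v (inject₁ t)) (v (Fin.suc t)) →
           (P : Pred (Fin n) 0ℓ) → P (v (inject₁ t)) ⊎ P (v (Fin.suc t)) →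
           ∃[ s ] (Between t s × ∃[ j ] (P (v j) × Adj G (v j) (vertex s)))
  detour t ¬adj P = λ where
      (inj₁ Pv) → after , (≤-reflexive (sym toℕ-after) , after<q) ,
        inject₁ t , Pv , subst (λ x → Adj G x (vertex after)) (visits _) (adjacent (inj₁ (sym toℕ-after)))
      (inj₂ Pv) → before , (p<before , ≤-reflexive suc-before) ,
        Fin.suc t , Pv , adj-sym G (subst (Adj G _) (visits _) (adjacent (inj₁ suc-before)))
    where
    p q : Fin length
    p = position (inject₁ t)
    q = position (Fin.suc t)

    p<q : p Fin.< q
    p<q = increasing (s≤s (≤-reflexive (Fin.toℕ-inject₁ t)))

    1+p<q : suc (toℕ p) < toℕ q
    1+p<q = ≤∧≢⇒< p<q λ 1+p≡q →
      ¬adj (subst₂ (Adj G) (visits _) (visits _) (adjacent (inj₁ 1+p≡q)))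

    after : Fin length
    after = fromℕ< (<-trans 1+p<q (Fin.toℕ<n q))

    toℕ-after : toℕ after ≡ suc (toℕ p)
    toℕ-after = Fin.toℕ-fromℕ< _

    after<q : after Fin.< q
    after<q = subst (_< toℕ q) (sym toℕ-after) 1+p<q

    before : Fin length
    before = Fin.pred q

    suc-before : suc (toℕ before) ≡ toℕ q
    suc-before = suc-pred-Fin q (≤-<-trans z≤n p<q)
      where
      suc-pred-Fin : ∀ {l} (i : Fin l) → 0 < toℕ i → suc (toℕ (Fin.pred i)) ≡ toℕ i
      suc-pred-Fin (Fin.suc i) _ = cong suc (Fin.toℕ-inject₁ i)

    p<before : p Fin.< before
    p<before = s≤s⁻¹ (subst (suc (toℕ p) <_) (sym suc-before) 1+p<q)

  module _ (P : Pred (Fin n) 0ℓ)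
           (nonadjacent : ∀ t → ¬ Adj G (v (inject₁ t)) (v (Fin.suc t)))
           (touches : ∀ t → P (v (inject₁ t)) ⊎ P (v (Fin.suc t)))
    where

    FreeNeighbour : Pred (Fin n) 0ℓ
    FreeNeighbour y = (∀ j → y ≢ v j) × ∃[ j ] (P (v j) × Adj G (v j) y)

    -- Pigeonhole: each of the `k` arcs contributes a free neighbour, and two with the same code
    -- would be one vertex, hence one position, on two disjoint arcs.
    free-neighbours-bound : ∀ {q} (code : Fin n → ℕ) →
      (∀ {y} → FreeNeighbour y → code y < q) →
      (∀ {y y′} → FreeNeighbour y → FreeNeighbour y′ → code y ≡ code y′ → y ≡ y′) →
      k ≤ q
    free-neighbours-bound {q} code code<q code-inj = ≮⇒≥ λ q<k →
      let t , t′ , t<t′ , eq = Fin.pigeonhole q<k (λ t → fromℕ< (code<q (free t)))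
          s≡s′ = injective (code-inj (free t) (free t′) (Fin.fromℕ<-injective _ _ _ _ eq))
      in <-irrefl (cong toℕ s≡s′) (between-mono t<t′ (between t) (between t′))
      where
      s : Fin k → Fin length
      s t = proj₁ (detour t (nonadjacent t) P (touches t))

      between : ∀ t → Between t (s t)
      between t = proj₁ (proj₂ (detour t (nonadjacent t) P (touches t)))

      free : ∀ t → FreeNeighbour (vertex (s t))
      free t = between⇒≢term (between t) ,
               proj₂ (proj₂ (detour t (nonadjacent t) P (touches t)))

-- Distance in powers of the cycle.

-- Cyclic distance at most `d`. The second alternative measures the arc through the edge joining
-- `n - 1` and `0`, written without truncated subtraction.
Close : ℕ → Fin n → Fin n → Set
Close {n} d x y = ∣ toℕ x - toℕ y ∣ ≤ d ⊎ n ≤ ∣ toℕ x - toℕ y ∣ + d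

∣n-1+n∣≡1 : ∀ a → ∣ a - suc a ∣ ≡ 1
∣n-1+n∣≡1 zero    = refl
∣n-1+n∣≡1 (suc a) = ∣n-1+n∣≡1 a

-- Across the edge joining n-1 and 0 the distances to a third vertex are
-- complementary.
next-distance : ∀ {x y : Fin n} → Next x y → ∀ z →
  ∣ toℕ x - toℕ y ∣ ≡ 1 ⊎ suc (∣ toℕ x - toℕ z ∣ + ∣ toℕ y - toℕ z ∣) ≡ n
next-distance {x = x} (inj₁ 1+x≡y) z = inj₁ (trans (cong ∣ toℕ x -_∣ (sym 1+x≡y)) (∣n-1+n∣≡1 (toℕ x)))
next-distance {x = x} (inj₂ (1+x≡n , y≡0)) z rewrite y≡0 = inj₂ (trans (cong suc
  (trans (cong (_+ toℕ z) (m≤n⇒∣n-m∣≡n∸m z≤x)) (m∸n+n≡m z≤x))) 1+x≡n)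
  where
  z≤x : toℕ z ≤ toℕ x
  z≤x = s≤s⁻¹ (subst (toℕ z <_) (sym 1+x≡n) (Fin.toℕ<n z))

module _ (3≤n : 3 ≤ n) where

  edge-distance : ∀ {x y : Fin n} → Adj (cycleGraph n 3≤n) x y → ∀ z →
    ∣ toℕ x - toℕ y ∣ ≡ 1 ⊎ suc (∣ toℕ x - toℕ z ∣ + ∣ toℕ y - toℕ z ∣) ≡ n
  edge-distance (inj₁ next) z = next-distance next z
  edge-distance {x} {y} (inj₂ next) z with next-distance next z
  ... | inj₁ eq = inj₁ (trans (∣-∣-comm (toℕ x) (toℕ y)) eq)
  ... | inj₂ eq = inj₂ (trans (cong suc (+-comm ∣ toℕ x - toℕ z ∣ _)) eq)

  -- Induction on the walk: an ordinary edge keeps the alternative at the cost of one step, while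
  -- the wrapping edge exchanges the two alternatives, since there `X + Y = n - 1`.
  walk⇒close : ∀ {x y d} → Walk (cycleGraph n 3≤n) x y d → Close d x y
  walk⇒close {x} nil = inj₁ (≤-reflexive (∣n-n∣≡0 (toℕ x)))
  walk⇒close {x} {z} {suc d} (cons {v = y} e w) = go (edge-distance e z) (walk⇒close w)
    where
    open ≤-Reasoning
    X Y : ℕ
    X = ∣ toℕ x - toℕ z ∣
    Y = ∣ toℕ y - toℕ z ∣

    go : ∣ toℕ x - toℕ y ∣ ≡ 1 ⊎ suc (X + Y) ≡ n → Close d y z → Close (suc d) x z
    go (inj₁ near) (inj₁ close) = inj₁ (begin
      X                      ≤⟨ ∣-∣-triangle (toℕ x) (toℕ y) (toℕ z) ⟩
      ∣ toℕ x - toℕ y ∣ + Y  ≡⟨ cong (_+ Y) near ⟩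
      suc Y                  ≤⟨ s≤s close ⟩
      suc d                  ∎)
    go (inj₁ near) (inj₂ far) = inj₂ (begin
      n                            ≤⟨ far ⟩
      Y + d                        ≤⟨ +-monoˡ-≤ d (∣-∣-triangle (toℕ y) (toℕ x) (toℕ z)) ⟩
      ∣ toℕ y - toℕ x ∣ + X + d    ≡⟨ cong (λ a → a + X + d) (trans (∣-∣-comm (toℕ y) (toℕ x)) near) ⟩
      suc (X + d)                  ≡⟨ +-suc X d ⟨
      X + suc d                    ∎)
    go (inj₂ wrap) (inj₁ close) = inj₂ (begin
      n              ≡⟨ wrap ⟨
      suc (X + Y)    ≤⟨ s≤s (+-monoʳ-≤ X close) ⟩
      suc (X + d)    ≡⟨ +-suc X d ⟨
      X + suc d      ∎)
    go (inj₂ wrap) (inj₂ far) = inj₁ (m≤n⇒m≤1+n (<⇒≤ (+-cancelʳ-< Y X d (begin-strict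
      X + Y          <⟨ ≤-reflexive wrap ⟩
      n              ≤⟨ far ⟩
      Y + d          ≡⟨ +-comm Y d ⟩
      d + Y          ∎))))

  adj⇒close : ∀ {x y} → Adj (power (cycleGraph n 3≤n) m) x y → Close m x y
  adj⇒close {m} (_ , d , D , d≤m) with walk⇒close (attained D)
  ... | inj₁ close = inj₁ (≤-trans close d≤m)
  ... | inj₂ far   = inj₂ (≤-trans far (+-monoʳ-≤ _ d≤m))

-- The interleaved sequence of terms.

-- Raising the index by two raises the value by one, so facts about successive terms reduce to
-- indices 0 and 1.
term : ℕ → ℕ → ℕ
term m 0             = suc m
term m 1             = 0
term m (suc (suc t)) = suc (term m t)

term-even : ∀ m i → term m (i * 2) ≡ suc m + i
term-even m zero    = cong suc (sym (+-identityʳ m))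
term-even m (suc i) = cong suc (trans (term-even m i) (sym (+-suc m i)))

term-odd : ∀ m i → term m (suc (i * 2)) ≡ i
term-odd m zero    = refl
term-odd m (suc i) = cong suc (term-odd m i)

term-gap : ∀ m t → ∣ term m t - term m (suc t) ∣ ≡ 1 + m ⊎ ∣ term m t - term m (suc t) ∣ ≡ 2 + m
term-gap m 0             = inj₁ refl
term-gap m 1             = inj₂ refl
term-gap m (suc (suc t)) = term-gap m t

term-high : ∀ m t → m < term m t ⊎ m < term m (suc t)
term-high m 0             = inj₁ ≤-refl
term-high m 1             = inj₂ (m≤n⇒m≤1+n ≤-refl)
term-high m (suc (suc t)) = [ inj₁ ∘ m≤n⇒m≤1+n , inj₂ ∘ m≤n⇒m≤1+n ]′ (term-high m t)

-- Doubling avoids halving `t`; even `t` attain equality.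
term≤ : ∀ m t → term m t * 2 ≤ suc m * 2 + t
term≤ m 0             = m≤m+n _ _
term≤ m 1             = z≤n
term≤ m (suc (suc t)) =
  subst (suc (suc (term m t * 2)) ≤_) (sym (trans (+-suc (suc m * 2) (suc t)) (cong suc (+-suc (suc m * 2) t))))
    (s≤s (s≤s (term≤ m t)))

-- The value `m` is skipped: even indices give values above `m`, and an odd index `2i + 1` below
-- `2m` gives `i < m`.
term≢ : ∀ m t → t < m * 2 → term m t ≢ m
term≢ m t t<2m with even-or-odd t
  where
  even-or-odd : ∀ t → ∃[ i ] (t ≡ i * 2 ⊎ t ≡ suc (i * 2))
  even-or-odd 0             = 0 , inj₁ refl
  even-or-odd 1             = 0 , inj₂ refl
  even-or-odd (suc (suc t)) with even-or-odd t
  ... | i , inj₁ refl = suc i , inj₁ refl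
  ... | i , inj₂ refl = suc i , inj₂ refl
... | i , inj₁ refl = λ eq → m+1+n≢m m (trans (+-suc m i) (trans (sym (term-even m i)) eq))
... | i , inj₂ refl = λ eq →
  <-irrefl (trans (sym (term-odd m i)) eq) (*-cancelʳ-< 2 i m (<-trans (n<1+n _) t<2m))

term-injective : ∀ m s t → s < m * 2 → t < m * 2 → term m s ≡ term m t → s ≡ t
term-injective m 0 0 _ _ _ = refl
term-injective m 1 1 _ _ _ = refl
-- Equal values would force `term m t` to be the skipped value `m`.
term-injective m 0 (suc (suc t)) _ lt eq =
  contradiction (sym (suc-injective eq)) (term≢ m t (<-trans (m≤n⇒m≤1+n ≤-refl) lt))
term-injective m (suc (suc s)) 0 lt _ eq =
  contradiction (suc-injective eq) (term≢ m s (<-trans (m≤n⇒m≤1+n ≤-refl) lt))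
term-injective m (suc (suc s)) (suc (suc t)) lt lt′ eq =
  cong (suc ∘ suc) (term-injective m s t (<-trans (m≤n⇒m≤1+n ≤-refl) lt)
    (<-trans (m≤n⇒m≤1+n ≤-refl) lt′) (suc-injective eq))

term<1+2m : ∀ m {t} → t < m * 2 → term m t < suc (m * 2)
term<1+2m m {t} t<2m = *-cancelʳ-< 2 (term m t) (suc (m * 2)) (begin-strict
  term m t * 2         ≤⟨ term≤ m t ⟩
  suc m * 2 + t        <⟨ +-monoʳ-< (suc m * 2) t<2m ⟩
  suc m * 2 + m * 2    ≡⟨ solve (m ∷ []) ⟩
  suc (m * 2) * 2      ∎)
  where open ≤-Reasoning

-- Below `2m`, the odd indices exhaust `0, …, m-1` and the even ones `m+1, …, 2m`.
not-term : ∀ m {y} → (∀ t → t < m * 2 → y ≢ term m t) → y ≡ m ⊎ m * 2 < y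
not-term m {y} y≢term with <-cmp y m
... | tri< y<m _ _ = contradiction (sym (term-odd m y))
  (y≢term (suc (y * 2)) (*-monoˡ-≤ 2 y<m))
... | tri≈ _ y≡m _ = inj₁ y≡m
... | tri> _ _ m<y = inj₂ (≰⇒> λ y≤2m →
  let i = y ∸ suc m
      y≡ = m+[n∸m]≡n m<y
      i<m = +-cancelˡ-≤ m (suc i) m (begin
        m + suc i   ≡⟨ +-suc m i ⟩
        suc m + i   ≡⟨ y≡ ⟩
        y           ≤⟨ y≤2m ⟩
        m * 2       ≡⟨ solve (m ∷ []) ⟩
        m + m       ∎)
  in y≢term (i * 2) (*-monoˡ-< 2 i<m) (sym (trans (term-even m i) y≡)))
  where open ≤-Reasoning

-- Neighbours of a vertex in `[m+1, 2m]`.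

-- Wrapping is excluded: if `y ≤ x`, then `x - y + m ≤ 3m < n`; otherwise `m < x` gives
-- `y - x + m ≤ y < n`.
close⇒≤ : {x y : Fin n} → m * 3 < n → m < toℕ x → toℕ x ≤ m * 2 → Close m x y → toℕ y ≤ m * 3
close⇒≤ {n} {m} {x} {y} 3m<n m<x x≤2m = λ where
    (inj₁ near) → begin
      toℕ y                        ≤⟨ m≤n+∣n-m∣ (toℕ y) (toℕ x) ⟩
      toℕ x + ∣ toℕ x - toℕ y ∣    ≤⟨ +-mono-≤ x≤2m near ⟩
      m * 2 + m                    ≡⟨ 2m+m≡3m ⟩
      m * 3                        ∎
    (inj₂ far) → contradiction far (<⇒≱ ([ far-≤ , far-≥ ]′ (≤-total (toℕ y) (toℕ x))))
  where
  open ≤-Reasoning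

  2m+m≡3m : m * 2 + m ≡ m * 3
  2m+m≡3m = solve (m ∷ [])

  far-≤ : toℕ y ≤ toℕ x → ∣ toℕ x - toℕ y ∣ + m < n
  far-≤ y≤x = begin-strict
    ∣ toℕ x - toℕ y ∣ + m    ≡⟨ cong (_+ m) (m≤n⇒∣n-m∣≡n∸m y≤x) ⟩
    toℕ x ∸ toℕ y + m        ≤⟨ +-monoˡ-≤ m (≤-trans (m∸n≤m (toℕ x) (toℕ y)) x≤2m) ⟩
    m * 2 + m                ≡⟨ 2m+m≡3m ⟩
    m * 3                    <⟨ 3m<n ⟩
    n                        ∎

  far-≥ : toℕ x ≤ toℕ y → ∣ toℕ x - toℕ y ∣ + m < n
  far-≥ x≤y = begin-strict
    ∣ toℕ x - toℕ y ∣ + m    ≡⟨ cong (_+ m) (m≤n⇒∣m-n∣≡n∸m x≤y) ⟩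
    toℕ y ∸ toℕ x + m        ≤⟨ +-monoʳ-≤ _ (<⇒≤ m<x) ⟩
    toℕ y ∸ toℕ x + toℕ x    ≡⟨ m∸n+n≡m x≤y ⟩
    toℕ y                    <⟨ Fin.toℕ<n y ⟩
    n                        ∎

-- The terms as vertices of the power.

module _ (m n : ℕ) (3m<n : m * 3 < n) (3≤n : 3 ≤ n) where

  index< : (t : Fin (2 * m)) → toℕ t < m * 2
  index< t = subst (toℕ t <_) (*-comm 2 m) (Fin.toℕ<n t)

  term<n : (t : Fin (2 * m)) → term m (toℕ t) < n
  term<n t = ≤-<-trans (s≤s⁻¹ (term<1+2m m (index< t))) (≤-<-trans (*-monoʳ-≤ m (n≤1+n 2)) 3m<n)

  terms : Fin (2 * m) → Fin n
  terms t = fromℕ< (term<n t)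

  toℕ-terms : ∀ t → toℕ (terms t) ≡ term m (toℕ t)
  toℕ-terms t = Fin.toℕ-fromℕ< (term<n t)

  toℕ-terms-suc : ∀ (s t : Fin (2 * m)) → toℕ t ≡ suc (toℕ s) → toℕ (terms t) ≡ term m (suc (toℕ s))
  toℕ-terms-suc s t t≡1+s = trans (toℕ-terms t) (cong (term m) t≡1+s)

  terms-injective : Injective _≡_ _≡_ terms
  terms-injective {s} {t} eq = Fin.toℕ-injective (term-injective m (toℕ s) (toℕ t)
    (index< s) (index< t) (Fin.fromℕ<-injective _ _ (term<n s) (term<n t) eq))

  consecutive⇒¬adj : 2 ≤ m → ∀ s t → toℕ t ≡ suc (toℕ s) →
    ¬ Adj (power (cycleGraph n 3≤n) m) (terms s) (terms t)
  consecutive⇒¬adj 2≤m s t t≡1+s adj =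
    [ <⇒≱ m<gap , <⇒≱ gap+m<n ]′ (adj⇒close 3≤n adj)
    where
    gap : ℕ
    gap = ∣ toℕ (terms s) - toℕ (terms t) ∣

    gap≡ : gap ≡ 1 + m ⊎ gap ≡ 2 + m
    gap≡ = subst₂ (λ a b → ∣ a - b ∣ ≡ 1 + m ⊎ ∣ a - b ∣ ≡ 2 + m)
      (sym (toℕ-terms s)) (sym (toℕ-terms-suc s t t≡1+s)) (term-gap m (toℕ s))

    m<gap : m < gap
    m<gap = [ ≤-reflexive ∘ sym , <⇒≤ ∘ ≤-reflexive ∘ sym ]′ gap≡

    gap+m<n : gap + m < n
    gap+m<n = begin-strict
      gap + m      ≤⟨ +-monoˡ-≤ m ([ (λ eq → <⇒≤ (s≤s (≤-reflexive eq))) , ≤-reflexive ]′ gap≡) ⟩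
      -- The larger gap `m + 2` leads to `2m + 2`, and `2 ≤ m` makes this at most `3m`.
      2 + m + m    ≤⟨ +-monoˡ-≤ m (+-monoˡ-≤ m 2≤m) ⟩
      m + m + m    ≡⟨ solve (m ∷ []) ⟩
      m * 3        <⟨ 3m<n ⟩
      n            ∎
      where open ≤-Reasoning

  consecutive-high : ∀ s t → toℕ t ≡ suc (toℕ s) → m < toℕ (terms s) ⊎ m < toℕ (terms t)
  consecutive-high s t t≡1+s = subst₂ (λ a b → m < a ⊎ m < b)
    (sym (toℕ-terms s)) (sym (toℕ-terms-suc s t t≡1+s)) (term-high m (toℕ s))

  ≢terms : ∀ {y} → (∀ j → y ≢ terms j) → toℕ y ≡ m ⊎ m * 2 < toℕ y
  ≢terms y≢ = not-term m λ t t<2m y≡ →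
    let t<2m′ = subst (t <_) (*-comm m 2) t<2m
        j = fromℕ< t<2m′
    in y≢ j (Fin.toℕ-injective
         (trans y≡ (sym (trans (toℕ-terms j) (cong (term m) (Fin.toℕ-fromℕ< t<2m′))))))

  -- Sends m to 0, by truncation, and 2m+1, …, 3m to 1, …, m.
  code : Fin n → ℕ
  code y = toℕ y ∸ m * 2

  -- Truncation identifies all values up to `2m`, but `m` is the only one of them outside the terms.
  code-injective : ∀ {y y′} → (∀ j → y ≢ terms j) → (∀ j → y′ ≢ terms j) →
    code y ≡ code y′ → y ≡ y′
  code-injective {y} {y′} y≢ y′≢ eq = Fin.toℕ-injective (case (≢terms y≢) (≢terms y′≢))
    where
    m≤2m : m ≤ m * 2
    m≤2m = m≤m*n m 2

    low≢high : ∀ {a b} → a ≡ m → m * 2 < b → a ∸ m * 2 ≢ b ∸ m * 2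
    low≢high refl 2m<b eq = m>n⇒m∸n≢0 2m<b (trans (sym eq) (m≤n⇒m∸n≡0 m≤2m))

    case : toℕ y ≡ m ⊎ m * 2 < toℕ y → toℕ y′ ≡ m ⊎ m * 2 < toℕ y′ → toℕ y ≡ toℕ y′
    case (inj₁ y≡m)  (inj₁ y′≡m)  = trans y≡m (sym y′≡m)
    case (inj₁ y≡m)  (inj₂ 2m<y′) = contradiction eq (low≢high y≡m 2m<y′)
    case (inj₂ 2m<y) (inj₁ y′≡m)  = contradiction (sym eq) (low≢high y′≡m 2m<y)
    case (inj₂ 2m<y) (inj₂ 2m<y′) = ∸-cancelʳ-≡ (<⇒≤ 2m<y) (<⇒≤ 2m<y′) eq

  code≤m : ∀ {y} → ∃[ j ] (m < toℕ (terms j) × Adj (power (cycleGraph n 3≤n) m) (terms j) y) →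
    code y ≤ m
  code≤m {y} (j , m<j , adj) = m≤n+o⇒m∸n≤o (toℕ y) (m * 2) (begin
    toℕ y        ≤⟨ close⇒≤ 3m<n m<j terms≤2m (adj⇒close 3≤n adj) ⟩
    m * 3        ≡⟨ solve (m ∷ []) ⟩
    m * 2 + m    ∎)
    where
    open ≤-Reasoning
    terms≤2m : toℕ (terms j) ≤ m * 2
    terms≤2m = subst (_≤ m * 2) (sym (toℕ-terms j)) (s≤s⁻¹ (term<1+2m m (index< j)))

proposition6p3 : ∀ (m : ℕ) → 3 ≤ m →
    ∃[ N ] (∀ (n : ℕ) → N ≤ n → (3≤n : 3 ≤ n) →
    ¬ Ordered (2 * m) (power (cycleGraph n 3≤n) m))
-- `N = 3m + 1` encodes `3m < n`. Writing `m` as `suc m′` exposes `2 * m` as a successor, so the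
-- bound applies with `k = 2m - 1`.
proposition6p3 m@(suc m′) 3≤m@(s≤s 2≤m′) = suc (m * 3) , λ n 3m<n 3≤n ordered →
  let _ , meets = ordered (terms m n 3m<n 3≤n) (terms-injective m n 3m<n 3≤n)
  in <⇒≱ 2+m′<2m′+1 (free-neighbours-bound meets (λ y → m < toℕ y)
       (λ t → consecutive⇒¬adj m n 3m<n 3≤n (<⇒≤ 3≤m) (inject₁ t) (Fin.suc t) (suc-inject₁ t))
       (λ t → consecutive-high m n 3m<n 3≤n (inject₁ t) (Fin.suc t) (suc-inject₁ t))
       (code m n 3m<n 3≤n)
       -- The codes are among `0, …, m`, hence `q = m + 1`.
       (λ (_ , near) → s≤s (code≤m m n 3m<n 3≤n near))
       (λ (y≢ , _) (y′≢ , _) → code-injective m n 3m<n 3≤n y≢ y′≢))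
  where
  suc-inject₁ : ∀ {l} (t : Fin l) → suc (toℕ t) ≡ suc (toℕ (inject₁ t))
  suc-inject₁ t = cong suc (sym (Fin.toℕ-inject₁ t))

  -- This is `m + 1 < 2m - 1`, where the full strength of `3 ≤ m` enters: at `m = 2` both sides are
  -- 3.
  2+m′<2m′+1 : 2 + m′ < m′ + (suc m′ + 0)
  2+m′<2m′+1 = subst (2 + m′ <_) (cong (m′ +_) (sym (+-identityʳ (suc m′))))
    (subst (_≤ m′ + suc m′) (+-suc 2 m′) (+-monoˡ-≤ (suc m′) 2≤m′))
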